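{- There is an $\mathcal{O}(n)$ time algorithm that, given any map $f\in F(n)$ stored in an array, rearranges $f$ in-place, unstably, into an idempotent map $\iota\in I(n)$ using $2\log n$ bits of additional space.
   Context: $[n]=\{1,2,\ldots,n\}$. $F(n)$ is the set of all maps $f:[n]\to[n]$, represented as sequences $f(1),\ldots,f(n)$. $I(n)\subseteq F(n)$ is the set of idempotent maps, i.e. those $\iota$ with $\iota(\iota(x))=\iota(x)$ for all $x\in[n]$. "Rearranges $f$ in-place into $\iota$" means: $f$ is stored in an array $D[1\ldots n]$ with $D_i=f(i)$, and at termination the same array holds $\iota$ with $D_i=\iota(i)$, where $\iota=f\circ\tau$ for some permutation $\tau$ of $[n]$. "Unstably" means no claim is made on the relative order of equal elements. Computation is on a unit-cost random access machine; "$c\log n$ bits" means that besides the array $c$ auxiliary variables of $\log n$ bits each (indices or values of magnitude $O(n)$) are used. -}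

module Defs where

open import Data.Fin.Base using (Fin; toℕ; fromℕ<)
open import Data.Fin.Permutation using (Permutation′; _⟨$⟩ʳ_)
open import Data.List.Base using (List; drop; head)
open import Data.Maybe.Base using (Maybe; just; nothing; map; zipWith; _>>=_)
open import Data.Nat.Base using (ℕ; zero; suc; _+_; _*_; _∸_; _≤_; _≥_)
open import Data.Nat.Properties using (_≟_; _<?_; _≤?_)
open import Data.Product.Base using (_×_; Σ-syntax; ∃-syntax)
open import Data.Vec.Base using (Vec; lookup; replicate; tabulate; _[_]≔_)
open import Data.Vec.Relation.Unary.All using (All)
open import Relation.Binary.PropositionalEquality using (_≡_)
open import Relation.Nullary.Decidable using (does; dec⇒maybe)
open import Data.Bool.Base using (Bool; if_then_else_)
import Algebra.Definitions

F : ℕ → Set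
F n = Fin n → Fin n

IsIdempotent : ∀ {n} → F n → Set
IsIdempotent {n} = IdempotentFun
  where open Algebra.Definitions {A = Fin n} _≡_

I : ℕ → Set
I n = Σ[ ι ∈ F n ] IsIdempotent ι

IsRearrangement : ∀ {n} → F n → F n → Set
IsRearrangement {n} f ι = Σ[ τ ∈ Permutation′ n ] (∀ x → ι x ≡ f (τ ⟨$⟩ʳ x))

-- g ∈O h : g n = O(h n) as n → ∞.
infix 4 _∈O_
_∈O_ : (ℕ → ℕ) → (ℕ → ℕ) → Set
g ∈O h = ∃[ c ] ∃[ n₀ ] (∀ n → n ≥ n₀ → g n ≤ c * h n)

------------------------------------------------------------------------
-- A unit-cost random access machine whose entire mutable data are an array
-- D[1 … n] with entries in [n] = {1, …, n} and k auxiliary variables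
-- holding natural numbers.

-- Fin n stands for [n]: the element i is the machine number 1 + toℕ i,
-- both as an array entry and as an array index.
encode : ∀ {n} → Fin n → ℕ
encode i = suc (toℕ i)

decode : ∀ n → ℕ → Maybe (Fin n)
decode n zero    = nothing
decode n (suc m) = map (λ m<n → fromℕ< m<n) (dec⇒maybe (m <? n))

data Place (k : ℕ) : Set where
  var  : Fin k → Place k
  D[_] : Fin k → Place k    -- the array entry whose index is in a variable

-- `size` is the read-only input parameter n.
data Operand (k : ℕ) : Set where
  const : ℕ → Operand k
  size  : Operand k
  at    : Place k → Operand k

data Expr (k : ℕ) : Set where
  val         : Operand k → Expr k
  _⊕_ _⊖_     : Operand k → Operand k → Expr k

data Test (k : ℕ) : Set where
  _==_ _<=_ : Operand k → Operand k → Test k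

Label : Set
Label = ℕ

data Instr (k : ℕ) : Set where
  _:=_   : Place k → Expr k → Instr k
  goto   : Label → Instr k
  branch : Test k → Label → Instr k

-- Labels are positions in the list.  The program does not depend on n.
Program : ℕ → Set
Program k = List (Instr k)

record Config (k n : ℕ) : Set where
  constructor ⟨_,_,_⟩
  field
    pc    : Label
    vars  : Vec ℕ k
    array : Vec (Fin n) n

open Config public

fetch : ∀ {k} → Program k → Label → Maybe (Instr k)
fetch P l = head (drop l P)

-- In the functions below `nothing` is a fault: an array access outside
-- 1 … n, or an attempt to store in the array a number outside [n].

module _ {k n : ℕ} where

  read : Config k n → Operand k → Maybe ℕ
  read c (const m)     = just m
  read c size          = just n
  read c (at (var r))  = just (lookup (vars c) r)
  read c (at D[ r ])   =
    map (λ i → encode (lookup (array c) i)) (decode n (lookup (vars c) r))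

  eval : Config k n → Expr k → Maybe ℕ
  eval c (val a) = read c a
  eval c (a ⊕ b) = zipWith _+_ (read c a) (read c b)
  eval c (a ⊖ b) = zipWith _∸_ (read c a) (read c b)

  test : Config k n → Test k → Maybe Bool
  test c (a == b) = zipWith (λ x y → does (x ≟ y)) (read c a) (read c b)
  test c (a <= b) = zipWith (λ x y → does (x ≤? y)) (read c a) (read c b)

  write : Config k n → Place k → ℕ → Maybe (Config k n)
  write ⟨ l , v , D ⟩ (var r)  m = just ⟨ l , v [ r ]≔ m , D ⟩
  write ⟨ l , v , D ⟩ D[ r ]   m =
    zipWith (λ i x → ⟨ l , v , D [ i ]≔ x ⟩) (decode n (lookup v r)) (decode n m)

  next : Config k n → Config k n
  next c = record c { pc = suc (pc c) }

  jump : Label → Config k n → Config k n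
  jump l c = record c { pc = l }

  exec : Instr k → Config k n → Maybe (Config k n)
  exec (p := e)     c = eval c e >>= λ m → write (next c) p m
  exec (goto l)     c = just (jump l c)
  exec (branch t l) c = map (λ b → if b then jump l c else next c) (test c t)

  -- Run P m c t D : started in c, P halts without fault after exactly t
  -- instructions with array D, and in every configuration on the way,
  -- including the first and the last, all variables are at most m.  The
  -- machine halts when there is no instruction at the current label.
  data Run (P : Program k) (m : ℕ) : Config k n → ℕ → Vec (Fin n) n → Set where
    halt : ∀ {c} → All (_≤ m) (vars c) →
           fetch P (pc c) ≡ nothing →
           Run P m c 0 (array c)
    step : ∀ {c c′ ins t D} → All (_≤ m) (vars c) →
           fetch P (pc c) ≡ just ins → exec ins c ≡ just c′ →
           Run P m c′ t D →
           Run P m c (suc t) D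

-- f is stored in the array, D_i = f(i), and all variables are 0.
initial : ∀ {n} k → F n → Config k n
initial k f = ⟨ 0 , replicate k 0 , tabulate f ⟩

-- On input f, P halts within t steps, variables bounded by m, with the
-- array storing ι.
Transforms : ∀ {k n} → Program k → (t m : ℕ) → F n → F n → Set
Transforms {k} P t m f ι =
  ∃[ s ] (s ≤ t × Run P m (initial k f) s (tabulate ι))

{-# OPTIONS --safe #-}
module Submission where

-- A map D is idempotent exactly when every value D(x) is a fixed point of D.
-- The machine visits i = 1, …, n and at each i repeats: let v = D(i); if
-- D(v) = v, go on to the next i; otherwise exchange the entries D(i) and
-- D(v), after which v is a fixed point.  As the value v is also the index of
-- its target, the exchange D(i) := D(v), D(v) := v needs no third variable,
-- so i and v are the only auxiliary data, and both stay in {0, …, n}.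
--
-- Correctness.  An exchange permutes the entries (`lookup-sendHome`), and it
-- does not spoil a position x ≠ i whose value is already a fixed point
-- (`settled-sendHome`); so once i has passed through 1, …, n the array is
-- idempotent.
--
-- Time.  An exchange keeps all fixed points and adds v to them
-- (`unfixed-sendHome`), so there are at most n exchanges in total, each at
-- a cost of five instructions, besides four instructions for each i and one
-- final test.

open import Defs
open import Data.Fin.Base using (Fin; zero; suc; toℕ; fromℕ<)
open import Data.Fin.Permutation
  using (_⟨$⟩ʳ_; _∘ₚ_; transpose) renaming (id to idₚ)
open import Data.Fin.Properties as Fin using (toℕ<n; toℕ-fromℕ<; fromℕ<-toℕ; toℕ-injective)
open import Data.Fin.Subset using (Subset; _∈_; _⊂_; ∣_∣)
open import Data.Fin.Subset.Properties using (p⊂q⇒∣p∣<∣q∣; ∣p∣≤n)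
open import Data.List.Base using ([]; _∷_)
open import Data.Maybe.Base using (just)
open import Data.Nat.Base using (ℕ; zero; suc; _+_; _*_; _≤_; _<_; z≤n; s≤s; s≤s⁻¹)
open import Data.Nat.Properties
  using (_≟_; _<?_; ≤-refl; ≤-reflexive; ≤-trans; <⇒≤; <⇒≢; m≤n⇒m<n∨m≡n; m<m+n; +-monoˡ-≤;
         +-identityʳ; +-suc; suc-injective)
open import Data.Nat.Tactic.RingSolver using (solve-∀)
open import Data.Product.Base using (_×_; Σ-syntax; ∃-syntax; _,_; proj₁)
open import Data.Sum.Base using (inj₁; inj₂)
open import Data.Vec.Base using (Vec; []; _∷_; lookup; tabulate; _[_]≔_)
open import Data.Vec.Properties
  using (lookup∘tabulate; tabulate∘lookup; lookup∘update; lookup∘update′; lookup⇒[]=; []=⇒lookup)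
open import Data.Vec.Relation.Unary.All using (All; []; _∷_)
open import Function.Base using (id; _∘_)
open import Relation.Binary.PropositionalEquality
  using (_≡_; _≢_; refl; sym; trans; cong; subst)
open import Relation.Nullary.Decidable using (yes; no; does; dec-true; dec-false; ¬?)
open import Relation.Nullary.Negation using (contradiction)

-- Fixed points and exchanges

module _ {n : ℕ} where

  Fixed : Vec (Fin n) n → Fin n → Set
  Fixed D x = lookup D x ≡ x

  -- The value at position x is a fixed point; if this holds for all x, then
  -- the array is idempotent.
  Settled : Vec (Fin n) n → Fin n → Set
  Settled D x = Fixed D (lookup D x)

  -- Exchange the entries at i and at v = D(i), so that v gets to position v.
  sendHome : Vec (Fin n) n → Fin n → Vec (Fin n) n
  sendHome D i = D [ i ]≔ lookup D (lookup D i) [ lookup D i ]≔ lookup D i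

  -- The positions that are not fixed points; their number bounds the number
  -- of exchanges still possible.
  unfixed : Vec (Fin n) n → Subset n
  unfixed D = tabulate λ x → does (¬? (lookup D x Fin.≟ x))

  ∈-unfixed⁺ : ∀ D {x} → lookup D x ≢ x → x ∈ unfixed D
  ∈-unfixed⁺ D {x} ≢x = lookup⇒[]= x _
    (trans (lookup∘tabulate _ x) (dec-true (¬? (lookup D x Fin.≟ x)) ≢x))

  ∈-unfixed⁻ : ∀ D {x} → x ∈ unfixed D → lookup D x ≢ x
  ∈-unfixed⁻ D {x} x∈ ≡x
    with () ← trans (sym (trans (sym (lookup∘tabulate _ x)) ([]=⇒lookup x∈)))
                    (dec-false (¬? (lookup D x Fin.≟ x)) (λ ≢x → ≢x ≡x))

  module _ (D : Vec (Fin n) n) (i : Fin n) where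

    private
      v : Fin n
      v = lookup D i

    sendHome-at-home : Fixed (sendHome D i) v
    sendHome-at-home = lookup∘update v (D [ i ]≔ lookup D v) v

    sendHome-at-source : i ≢ v → lookup (sendHome D i) i ≡ lookup D v
    sendHome-at-source i≢v = trans
      (lookup∘update′ i≢v (D [ i ]≔ lookup D v) v)
      (lookup∘update i D (lookup D v))

    sendHome-elsewhere : ∀ {x} → x ≢ i → x ≢ v → lookup (sendHome D i) x ≡ lookup D x
    sendHome-elsewhere x≢i x≢v = trans
      (lookup∘update′ x≢v (D [ i ]≔ lookup D v) v)
      (lookup∘update′ x≢i D (lookup D v))

    module _ (unsettled : lookup D v ≢ v) where

      unsettled⇒≢ : i ≢ v
      unsettled⇒≢ i≡v = unsettled (cong (lookup D) (sym i≡v))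

      lookup-sendHome : ∀ x → lookup (sendHome D i) x ≡ lookup D (transpose i v ⟨$⟩ʳ x)
      lookup-sendHome x with x Fin.≟ i
      ... | yes refl = sendHome-at-source unsettled⇒≢
      ... | no x≢i with x Fin.≟ v
      ...   | yes refl = sendHome-at-home
      ...   | no x≢v   = sendHome-elsewhere x≢i x≢v

      fixed-sendHome : ∀ {x} → Fixed D x → Fixed (sendHome D i) x
      fixed-sendHome {x} fixed = trans (sendHome-elsewhere x≢i x≢v) fixed
        where
        x≢i : x ≢ i
        x≢i refl = unsettled⇒≢ (sym fixed)
        x≢v : x ≢ v
        x≢v refl = unsettled fixed

      settled-sendHome : ∀ {x} → x ≢ i → Settled D x → Settled (sendHome D i) x
      settled-sendHome {x} x≢i settled with x Fin.≟ v
      ... | yes refl = subst (Fixed (sendHome D i)) (sym sendHome-at-home) sendHome-at-home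
      ... | no x≢v   = subst (Fixed (sendHome D i)) (sym (sendHome-elsewhere x≢i x≢v))
                         (fixed-sendHome settled)

      unfixed-sendHome : unfixed (sendHome D i) ⊂ unfixed D
      unfixed-sendHome =
        (λ x∈ → ∈-unfixed⁺ D (∈-unfixed⁻ (sendHome D i) x∈ ∘ fixed-sendHome)) ,
        v , ∈-unfixed⁺ D unsettled ,
        λ v∈ → ∈-unfixed⁻ (sendHome D i) v∈ sendHome-at-home

-- The program and the effect of its instructions

-- Variable 0 holds i, which is 0 before the first visit; variable 1 holds v.
-- Label 0 starts the next visit, or halts if i = n; label 2 starts a round of
-- the inner loop.
program : Program 2
program =
    branch (at (var zero) == size) 7
  ∷ (var zero := (const 1 ⊕ at (var zero)))
  ∷ (var (suc zero) := val (at D[ zero ]))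
  ∷ branch (at D[ suc zero ] == at (var (suc zero))) 0
  ∷ (D[ zero ] := val (at D[ suc zero ]))
  ∷ (D[ suc zero ] := val (at (var (suc zero))))
  ∷ goto 2
  ∷ []

decode-encode : ∀ {n} (i : Fin n) → decode n (encode i) ≡ just i
decode-encode {n} i with toℕ i <? n
... | yes i<n = cong just (fromℕ<-toℕ i i<n)
... | no i≮n  = contradiction (toℕ<n i) i≮n

module _ {n : ℕ} where

  exec-load : ∀ {l v} D (i : Fin n) →
    exec (var (suc zero) := val (at D[ zero ])) ⟨ l , encode i ∷ v ∷ [] , D ⟩
      ≡ just ⟨ suc l , encode i ∷ encode (lookup D i) ∷ [] , D ⟩
  exec-load D i rewrite decode-encode i = refl

  exec-copy : ∀ {l} D (i v : Fin n) →
    exec (D[ zero ] := val (at D[ suc zero ])) ⟨ l , encode i ∷ encode v ∷ [] , D ⟩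
      ≡ just ⟨ suc l , encode i ∷ encode v ∷ [] , D [ i ]≔ lookup D v ⟩
  exec-copy D i v
    rewrite decode-encode v | decode-encode i | decode-encode (lookup D v) = refl

  exec-store : ∀ {l u} D (v : Fin n) →
    exec (D[ suc zero ] := val (at (var (suc zero)))) ⟨ l , u ∷ encode v ∷ [] , D ⟩
      ≡ just ⟨ suc l , u ∷ encode v ∷ [] , D [ v ]≔ v ⟩
  exec-store D v rewrite decode-encode v = refl

  exec-branch-fixed : ∀ {l l′ u} D (v : Fin n) → Fixed D v →
    exec (branch (at D[ suc zero ] == at (var (suc zero))) l′) ⟨ l , u ∷ encode v ∷ [] , D ⟩
      ≡ just ⟨ l′ , u ∷ encode v ∷ [] , D ⟩
  exec-branch-fixed D v fixed
    rewrite decode-encode v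
          | dec-true (encode (lookup D v) ≟ encode v) (cong encode fixed) = refl

  exec-branch-unfixed : ∀ {l l′ u} D (v : Fin n) → lookup D v ≢ v →
    exec (branch (at D[ suc zero ] == at (var (suc zero))) l′) ⟨ l , u ∷ encode v ∷ [] , D ⟩
      ≡ just ⟨ suc l , u ∷ encode v ∷ [] , D ⟩
  exec-branch-unfixed D v unfixed
    rewrite decode-encode v
          | dec-false (encode (lookup D v) ≟ encode v)
              (unfixed ∘ toℕ-injective ∘ suc-injective) = refl

  exec-branch-end : ∀ {l l′ v} {D : Vec (Fin n) n} →
    exec (branch (at (var zero) == size) l′) ⟨ l , n ∷ v ∷ [] , D ⟩
      ≡ just ⟨ l′ , n ∷ v ∷ [] , D ⟩
  exec-branch-end rewrite dec-true (n ≟ n) refl = refl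

  exec-branch-continue : ∀ {l l′ i v} {D : Vec (Fin n) n} → i ≢ n →
    exec (branch (at (var zero) == size) l′) ⟨ l , i ∷ v ∷ [] , D ⟩
      ≡ just ⟨ suc l , i ∷ v ∷ [] , D ⟩
  exec-branch-continue {i = i} i≢n rewrite dec-false (i ≟ n) i≢n = refl

-- Correctness and running time

module _ {n : ℕ} (f : F n) where

  -- From c the program halts within t steps, with the variables at most n
  -- throughout, and leaves an idempotent rearrangement of f in the array.
  Succeeds : Config 2 n → ℕ → Set
  Succeeds c t = Σ[ ι ∈ I n ] IsRearrangement f (proj₁ ι) ×
    ∃[ s ] (s ≤ t × Run program n c s (tabulate (proj₁ ι)))

  succeeds-step : ∀ {c c′ ins t} → All (_≤ n) (vars c) →
    fetch program (pc c) ≡ just ins → exec ins c ≡ just c′ →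
    Succeeds c′ t → Succeeds c (suc t)
  succeeds-step bound fetched executed (ι , rearr , s , s≤t , run) =
    ι , rearr , suc s , s≤s s≤t , step bound fetched executed run

  succeeds-weaken : ∀ {c t t′} → t ≤ t′ → Succeeds c t → Succeeds c t′
  succeeds-weaken t≤t′ (ι , rearr , s , s≤t , run) =
    ι , rearr , s , ≤-trans s≤t t≤t′ , run

  -- The final array, read as a function, serves as ι; label 7 lies past the
  -- last instruction.
  succeeds-halt : ∀ {i v} D → IsRearrangement f (lookup D) → (∀ x → Settled D x) →
    i ≤ n → v ≤ n → Succeeds ⟨ 7 , i ∷ v ∷ [] , D ⟩ 0
  succeeds-halt {i} {v} D rearr settled i≤n v≤n =
    (lookup D , settled) , rearr , 0 , z≤n ,
    subst (Run program n ⟨ 7 , i ∷ v ∷ [] , D ⟩ 0) (sym (tabulate∘lookup D))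
      (halt (i≤n ∷ v≤n ∷ []) refl)

  rearrangement-sendHome : ∀ D i → lookup D (lookup D i) ≢ lookup D i →
    IsRearrangement f (lookup D) → IsRearrangement f (lookup (sendHome D i))
  rearrangement-sendHome D i unsettled (τ , D≡f∘τ) =
    transpose i (lookup D i) ∘ₚ τ ,
    λ x → trans (lookup-sendHome D i unsettled x) (D≡f∘τ _)

  -- The outer and the inner loop, run from the labels 0 and 2.  Variable 0
  -- has r increments still to come, and k bounds the number of exchanges to
  -- come; the recursion is lexicographic in (r , k).  In both, every position
  -- visited earlier is settled.
  visit-all : ∀ r k i v D → i + r ≡ n → v ≤ n → ∣ unfixed D ∣ ≤ k →
    IsRearrangement f (lookup D) → (∀ x → toℕ x < i → Settled D x) →
    Succeeds ⟨ 0 , i ∷ v ∷ [] , D ⟩ (1 + (r * 4 + k * 5))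

  settle : ∀ r k (i : Fin n) u D → encode i + r ≡ n → u ≤ n → ∣ unfixed D ∣ ≤ k →
    IsRearrangement f (lookup D) → (∀ x → toℕ x < toℕ i → Settled D x) →
    Succeeds ⟨ 2 , encode i ∷ u ∷ [] , D ⟩ (3 + (r * 4 + k * 5))

  visit-all zero k i v D i+0≡n v≤n unfixed≤k rearr settled
    with refl ← trans (sym (+-identityʳ i)) i+0≡n =
    succeeds-weaken (s≤s z≤n)
      (succeeds-step (≤-refl ∷ v≤n ∷ []) refl exec-branch-end
        (succeeds-halt D rearr (λ x → settled x (toℕ<n x)) ≤-refl v≤n))
  visit-all (suc r) k i v D i+r≡n v≤n unfixed≤k rearr settled
    with i<n ← subst (i <_) i+r≡n (m<m+n i (s≤s z≤n))
    -- The next machine index is i + 1, which encodes the element of Fin n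
    -- whose toℕ is i.
    with j ← fromℕ< i<n | refl ← toℕ-fromℕ< i<n =
    succeeds-step (<⇒≤ i<n ∷ v≤n ∷ []) refl (exec-branch-continue (<⇒≢ i<n))
    (succeeds-step (<⇒≤ i<n ∷ v≤n ∷ []) refl refl
    (settle r k _ v D (trans (sym (+-suc i r)) i+r≡n) v≤n unfixed≤k rearr settled))

  settle r k i u D i+r≡n u≤n unfixed≤k rearr settled
    with lookup D (lookup D i) Fin.≟ lookup D i
  ... | yes home =
    succeeds-step (toℕ<n i ∷ u≤n ∷ []) refl (exec-load {v = u} D i)
    (succeeds-step (toℕ<n i ∷ toℕ<n v ∷ []) refl (exec-branch-fixed D v home)
    (visit-all r k (encode i) (encode v) D i+r≡n (toℕ<n v) unfixed≤k rearr settled′))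
    where
    v : Fin n
    v = lookup D i
    settled′ : ∀ x → toℕ x < encode i → Settled D x
    settled′ x (s≤s x≤i) with m≤n⇒m<n∨m≡n x≤i
    ... | inj₁ x<i = settled x x<i
    ... | inj₂ x≡i rewrite toℕ-injective x≡i = home
  ... | no unsettled = exchange k unfixed≤k
    where
    v : Fin n
    v = lookup D i
    fewer : ∣ unfixed (sendHome D i) ∣ < ∣ unfixed D ∣
    fewer = p⊂q⇒∣p∣<∣q∣ (unfixed-sendHome D i unsettled)
    settled′ : ∀ x → toℕ x < toℕ i → Settled (sendHome D i) x
    settled′ x x<i = settled-sendHome D i unsettled (<⇒≢ x<i ∘ cong toℕ) (settled x x<i)
    bounds : All (_≤ n) (encode i ∷ encode v ∷ [])
    bounds = toℕ<n i ∷ toℕ<n v ∷ []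
    exchange : ∀ k → ∣ unfixed D ∣ ≤ k →
      Succeeds ⟨ 2 , encode i ∷ u ∷ [] , D ⟩ (3 + (r * 4 + k * 5))
    -- An exchange lowers the number of unfixed points, so k is not 0.
    exchange zero    unfixed≤k with () ← ≤-trans fewer unfixed≤k
    exchange (suc k) unfixed≤k =
      succeeds-weaken (≤-reflexive (regroup r k))
      (succeeds-step (toℕ<n i ∷ u≤n ∷ []) refl (exec-load {v = u} D i)
      (succeeds-step bounds refl (exec-branch-unfixed D v unsettled)
      (succeeds-step bounds refl (exec-copy D i v)
      (succeeds-step bounds refl (exec-store (D [ i ]≔ lookup D v) v)
      (succeeds-step bounds refl refl
      (settle r k i (encode v) (sendHome D i) i+r≡n (toℕ<n v)
        (s≤s⁻¹ (≤-trans fewer unfixed≤k))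
        (rearrangement-sendHome D i unsettled rearr) settled′))))))
      where
      regroup : ∀ r k → 5 + (3 + (r * 4 + k * 5)) ≡ 3 + (r * 4 + suc k * 5)
      regroup = solve-∀

  initial-succeeds : Succeeds (initial 2 f) (1 + (n * 4 + n * 5))
  initial-succeeds = visit-all n n 0 0 (tabulate f) refl z≤n (∣p∣≤n (unfixed (tabulate f)))
    (idₚ , lookup∘tabulate f) (λ _ ())

linear-time : (λ n → 1 + (n * 4 + n * 5)) ∈O id
linear-time = 10 , 1 , λ n n≥1 →
  ≤-trans (+-monoˡ-≤ (n * 4 + n * 5) n≥1) (≤-reflexive (regroup n))
  where
  regroup : ∀ n → n + (n * 4 + n * 5) ≡ 10 * n
  regroup = solve-∀

linear-magnitude : id ∈O id
linear-magnitude = 1 , 0 , λ n _ → ≤-reflexive (sym (+-identityʳ n))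

theorem2p4 : Σ[ P ∈ Program 2 ] Σ[ time ∈ (ℕ → ℕ) ] Σ[ magnitude ∈ (ℕ → ℕ) ]
    time ∈O id × magnitude ∈O id ×
    (∀ n (f : F n) → Σ[ ι ∈ I n ]
    IsRearrangement f (proj₁ ι) ×
    Transforms P (time n) (magnitude n) f (proj₁ ι))
theorem2p4 = program , _ , _ , linear-time , linear-magnitude , λ n f → initial-succeeds f
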